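{- Let $(G,\precsim)$ be a C-quasi-ordered group and let $1\neq g\in G$ be v-type. The group $G_g$ is the smallest normal convex subgroup of $G^g$ such that the quotient $G^g/G_g$ (with the quasi-order induced by $\precsim$) is valuational.
   Context: A quasi-order is a reflexive, transitive and total binary relation $\precsim$; $a\sim b$ means $a\precsim b\precsim a$, and $a\precnsim b$ means $a\precsim b$ and $a\nsim b$. An element $c$ is between $a$ and $b$ if $a\precsim c\precsim b$ or $b\precsim c\precsim a$. A subset $S$ is convex if for all $s,t\in S$, $s\precsim a\precsim t$ implies $a\in S$. A C-relation on a set is a ternary relation $C$ such that for all $x,y,z,w$: $C(x,y,z)\Rightarrow C(x,z,y)$; $C(x,y,z)\Rightarrow\neg C(y,x,z)$; $C(x,y,z)\Rightarrow C(w,y,z)\vee C(x,w,z)$; $x\neq y\Rightarrow C(x,y,y)$. On a group it is compatible if $C(x,y,z)$ implies $C(vxu,vyu,vzu)$ for all $x,y,z,u,v$. A C-quasi-order on a group $G$ is a quasi-order of the form $x\precsim y\Leftrightarrow\neg C(x,y,1)$ with $C$ a compatible C-relation; a C-quasi-ordered group is a group with a C-quasi-order. With $g^z:=zgz^{ -1}$, a valuation on a group is a map $v$ to $\Gamma\cup\{\infty\}$ ($\Gamma$ totally ordered, $\gamma<\infty$ for all $\gamma\in\Gamma$) with $v(g)=\infty\Leftrightarrow g=1$, $v(gh^{ -1})\geq\min(v(g),v(h))$, $v(g)\leq v(h)\Leftrightarrow v(g^z)\leq v(h^z)$. A C-quasi-order is valuational if there is a valuation $v$ with $g\precsim h\Leftrightarrow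 v(g)\geq v(h)$. If $H$ is a convex normal subgroup of a C-quasi-ordered group $(K,\precsim)$, the C-quasi-order induced on $K/H$ is $aH\precsim bH\Leftrightarrow a\in H\vee(b\notin H\wedge a\precsim b)$. $g$ is v-type if $g\sim g^{ -1}$; $o^+$-type if $g^{ -1}\precnsim g$. For $g\neq1$ v-type, $T_g$ is the set of v-type elements $h\neq1$ such that there is no $o^+$-type element between $h$ and $g$; $G_g:=\{h\in G\mid h\precnsim t\text{ for all }t\in T_g\}$; $G^g:=G_g\cup T_g$. (Both $G_g$ and $G^g$ are subgroups of $G$.) -}

module Defs where

open import Algebra.Bundles using (Group)
import Algebra.Construct.NaturalChoice.Min as Min
import Algebra.Properties.Group as GroupProperties
open import Data.Product.Base using (Σ; Σ-syntax; ∃-syntax; _×_; _,_; proj₁; proj₂)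
open import Data.Sum.Base using (_⊎_)
open import Function.Base using (_on_)
open import Function.Bundles using (_⇔_)
open import Level using (Level; suc)
open import Relation.Binary.Bundles using (TotalOrder)
open import Relation.Binary.Core using (Rel)
open import Relation.Binary.Structures using (IsTotalPreorder)
import Relation.Binary.Construct.Add.Supremum.Equality as AddSupEquality
import Relation.Binary.Construct.Add.Supremum.NonStrict as AddSup
open import Relation.Nullary.Construct.Add.Supremum using (_⁺; ⊤⁺)
open import Relation.Nullary.Negation.Core using (¬_)
open import Relation.Unary using (Pred; _⊆_; _∪_; _∈_; _∉_)
import Relation.Binary.Definitions as B
import Relation.Binary.Reasoning.Setoid as SetoidReasoning

-- Everything lives in one (arbitrary) universe level a; sets are setoids, so
-- relations, subsets and maps are required to respect the equality _≈_.

module QuasiOrder {a : Level} {A : Set a} (_≲_ : Rel A a) where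

  infix 4 _∼_ _≺_

  _∼_ : Rel A a
  x ∼ y = x ≲ y × y ≲ x

  _≺_ : Rel A a
  x ≺ y = x ≲ y × ¬ (x ∼ y)

  Between : A → A → A → Set a
  Between c x y = (x ≲ c × c ≲ y) ⊎ (y ≲ c × c ≲ x)

  Convex : Pred A a → Set a
  Convex S = ∀ {s x t} → s ∈ S → t ∈ S → s ≲ x → x ≲ t → x ∈ S

module _ {a : Level} (G : Group a a) where

  open Group G

  infixl 9 _^_

  _^_ : Carrier → Carrier → Carrier
  g ^ z = z ∙ g ∙ z ⁻¹

  record IsCRelation (C : Carrier → Carrier → Carrier → Set a) : Set a where
    field
      C-cong  : ∀ {x x′ y y′ z z′} → x ≈ x′ → y ≈ y′ → z ≈ z′ → C x y z → C x′ y′ z′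
      C-swap  : ∀ x y z → C x y z → C x z y
      C-asym  : ∀ x y z → C x y z → ¬ C y x z
      C-split : ∀ x y z w → C x y z → C w y z ⊎ C x w z
      C-diag  : ∀ x y → ¬ (x ≈ y) → C x y y

  Compatible : (Carrier → Carrier → Carrier → Set a) → Set a
  Compatible C = ∀ x y z u v → C x y z → C (v ∙ x ∙ u) (v ∙ y ∙ u) (v ∙ z ∙ u)

  record IsCQuasiOrder (_≲_ : Rel Carrier a) : Set (suc a) where
    field
      isTotalPreorder : IsTotalPreorder _≈_ _≲_
      C               : Carrier → Carrier → Carrier → Set a
      isCRelation     : IsCRelation C
      compatible      : Compatible C
      ≲⇔¬C            : ∀ x y → (x ≲ y) ⇔ (¬ C x y ε)

  record IsSubgroup (S : Pred Carrier a) : Set a where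
    field
      resp      : S B.Respects _≈_
      ε-closed  : ε ∈ S
      ∙-closed  : ∀ {x y} → x ∈ S → y ∈ S → (x ∙ y) ∈ S
      ⁻¹-closed : ∀ {x} → x ∈ S → (x ⁻¹) ∈ S

  record IsNormalSubgroup (H : Pred Carrier a) : Set a where
    field
      isSubgroup  : IsSubgroup H
      conj-closed : ∀ {h} z → h ∈ H → (h ^ z) ∈ H
    open IsSubgroup isSubgroup public

  record Valuation : Set (suc a) where
    field
      Γ : TotalOrder a a a

    private module Γ = TotalOrder Γ

    Γ∞ : TotalOrder a a a
    Γ∞ = record
      { Carrier      = Γ.Carrier ⁺
      ; _≈_          = AddSupEquality._≈⁺_ Γ._≈_
      ; _≤_          = AddSup._≤⁺_ Γ._≤_
      ; isTotalOrder = AddSup.≤⁺-isTotalOrder Γ._≤_ Γ.isTotalOrder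
      }

    open TotalOrder Γ∞ public
      using () renaming (Carrier to Value; _≈_ to _≈ᵥ_; _≤_ to _≤ᵥ_)
    open Min Γ∞ public using (_⊓_)

    field
      v         : Carrier → Value
      v-cong    : ∀ {x y} → x ≈ y → v x ≈ᵥ v y
      v-∞       : ∀ g → (v g ≈ᵥ ⊤⁺) ⇔ (g ≈ ε)
      v-ultra   : ∀ g h → (v g ⊓ v h) ≤ᵥ v (g ∙ h ⁻¹)
      v-conj    : ∀ g h z → (v g ≤ᵥ v h) ⇔ (v (g ^ z) ≤ᵥ v (h ^ z))

  IsValuational : Rel Carrier a → Set (suc a)
  IsValuational _≲_ = Σ[ val ∈ Valuation ] let open Valuation val in
    (∀ g h → (g ≲ h) ⇔ (v h ≤ᵥ v g))

record CQuasiOrderedGroup (a : Level) : Set (suc a) where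
  infix 4 _≲_
  field
    group         : Group a a
  open Group group public
  field
    _≲_           : Rel Carrier a
    isCQuasiOrder : IsCQuasiOrder group _≲_
  open IsCQuasiOrder isCQuasiOrder public
  open QuasiOrder _≲_ public

module _ {a : Level} (G : Group a a) where

  open Group G

  subgroup : {S : Pred Carrier a} → IsSubgroup G S → Group a a
  subgroup {S} isSub = record
    { Carrier = Σ Carrier S
    ; _≈_     = _≈_ on proj₁
    ; _∙_     = λ (x , x∈S) (y , y∈S) → x ∙ y , ∙-closed x∈S y∈S
    ; ε       = ε , ε-closed
    ; _⁻¹     = λ (x , x∈S) → x ⁻¹ , ⁻¹-closed x∈S
    ; isGroup = record
      { isMonoid = record
        { isSemigroup = record
          { isMagma = record
            { isEquivalence = record { refl = refl ; sym = sym ; trans = trans }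
            ; ∙-cong        = ∙-cong
            }
          ; assoc = λ x y z → assoc (proj₁ x) (proj₁ y) (proj₁ z)
          }
        ; identity = (λ x → identityˡ (proj₁ x)) , (λ x → identityʳ (proj₁ x))
        }
      ; inverse = (λ x → inverseˡ (proj₁ x)) , (λ x → inverseʳ (proj₁ x))
      ; ⁻¹-cong = ⁻¹-cong
      }
    }
    where open IsSubgroup isSub

  -- G/H: an element x represents its coset xH, and xH = yH iff x⁻¹y ∈ H.
  quotient : {H : Pred Carrier a} → IsNormalSubgroup G H → Group a a
  quotient {H} isNormal = record
    { Carrier = Carrier
    ; _≈_     = _≈ᴴ_
    ; _∙_     = _∙_
    ; ε       = ε
    ; _⁻¹     = _⁻¹
    ; isGroup = record
      { isMonoid = record
        { isSemigroup = record
          { isMagma = record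
            { isEquivalence = record
              { refl  = ≈⇒≈ᴴ refl
              ; sym   = ≈ᴴ-sym
              ; trans = ≈ᴴ-trans
              }
            ; ∙-cong = ≈ᴴ-∙-cong
            }
          ; assoc = λ x y z → ≈⇒≈ᴴ (assoc x y z)
          }
        ; identity = (λ x → ≈⇒≈ᴴ (identityˡ x)) , (λ x → ≈⇒≈ᴴ (identityʳ x))
        }
      ; inverse = (λ x → ≈⇒≈ᴴ (inverseˡ x)) , (λ x → ≈⇒≈ᴴ (inverseʳ x))
      ; ⁻¹-cong = ≈ᴴ-⁻¹-cong
      }
    }
    where
    open IsNormalSubgroup isNormal
    open GroupProperties G
    open SetoidReasoning setoid

    _≈ᴴ_ : Rel Carrier a
    x ≈ᴴ y = (x ⁻¹ ∙ y) ∈ H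

    ≈⇒≈ᴴ : ∀ {x y} → x ≈ y → x ≈ᴴ y
    ≈⇒≈ᴴ {x} x≈y = resp (trans (sym (inverseˡ x)) (∙-congˡ x≈y)) ε-closed

    inv-eq : ∀ x y → (x ⁻¹ ∙ y) ⁻¹ ≈ y ⁻¹ ∙ x
    inv-eq x y = trans (⁻¹-anti-homo-∙ (x ⁻¹) y) (∙-congˡ (⁻¹-involutive x))

    cancel : ∀ x y z → (x ∙ y ⁻¹) ∙ (y ∙ z) ≈ x ∙ z
    cancel x y z = begin
      (x ∙ y ⁻¹) ∙ (y ∙ z)  ≈⟨ assoc x (y ⁻¹) (y ∙ z) ⟩
      x ∙ (y ⁻¹ ∙ (y ∙ z))  ≈⟨ ∙-congˡ (assoc (y ⁻¹) y z) ⟨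
      x ∙ ((y ⁻¹ ∙ y) ∙ z)  ≈⟨ ∙-congˡ (∙-congʳ (inverseˡ y)) ⟩
      x ∙ (ε ∙ z)           ≈⟨ ∙-congˡ (identityˡ z) ⟩
      x ∙ z                 ∎

    cancel′ : ∀ x y z → (x ∙ y) ∙ (y ⁻¹ ∙ z) ≈ x ∙ z
    cancel′ x y z = trans (∙-congʳ (∙-congˡ (sym (⁻¹-involutive y)))) (cancel x (y ⁻¹) z)

    ≈ᴴ-sym : ∀ {x y} → x ≈ᴴ y → y ≈ᴴ x
    ≈ᴴ-sym {x} {y} p = resp (inv-eq x y) (⁻¹-closed p)

    ≈ᴴ-trans : ∀ {x y z} → x ≈ᴴ y → y ≈ᴴ z → x ≈ᴴ z
    ≈ᴴ-trans {x} {y} {z} p q = resp (cancel′ (x ⁻¹) y z) (∙-closed p q)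

    ≈ᴴ-∙-cong : ∀ {x x′ y y′} → x ≈ᴴ x′ → y ≈ᴴ y′ → (x ∙ y) ≈ᴴ (x′ ∙ y′)
    ≈ᴴ-∙-cong {x} {x′} {y} {y′} p q =
      resp eq (∙-closed (conj-closed (y ⁻¹) p) q)
      where
      eq : _^_ G (x ⁻¹ ∙ x′) (y ⁻¹) ∙ (y ⁻¹ ∙ y′) ≈ (x ∙ y) ⁻¹ ∙ (x′ ∙ y′)
      eq = begin
        (y ⁻¹ ∙ (x ⁻¹ ∙ x′) ∙ (y ⁻¹) ⁻¹) ∙ (y ⁻¹ ∙ y′)
          ≈⟨ cancel (y ⁻¹ ∙ (x ⁻¹ ∙ x′)) (y ⁻¹) y′ ⟩
        y ⁻¹ ∙ (x ⁻¹ ∙ x′) ∙ y′      ≈⟨ ∙-congʳ (assoc (y ⁻¹) (x ⁻¹) x′) ⟨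
        (y ⁻¹ ∙ x ⁻¹) ∙ x′ ∙ y′      ≈⟨ assoc (y ⁻¹ ∙ x ⁻¹) x′ y′ ⟩
        (y ⁻¹ ∙ x ⁻¹) ∙ (x′ ∙ y′)    ≈⟨ ∙-congʳ (⁻¹-anti-homo-∙ x y) ⟨
        (x ∙ y) ⁻¹ ∙ (x′ ∙ y′)       ∎

    ≈ᴴ-⁻¹-cong : ∀ {x y} → x ≈ᴴ y → (x ⁻¹) ≈ᴴ (y ⁻¹)
    ≈ᴴ-⁻¹-cong {x} {y} p = resp eq (conj-closed x (≈ᴴ-sym p))
      where
      eq : _^_ G (y ⁻¹ ∙ x) x ≈ (x ⁻¹) ⁻¹ ∙ y ⁻¹
      eq = begin
        x ∙ (y ⁻¹ ∙ x) ∙ x ⁻¹    ≈⟨ assoc x (y ⁻¹ ∙ x) (x ⁻¹) ⟩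
        x ∙ (y ⁻¹ ∙ x ∙ x ⁻¹)    ≈⟨ ∙-congˡ (assoc (y ⁻¹) x (x ⁻¹)) ⟩
        x ∙ (y ⁻¹ ∙ (x ∙ x ⁻¹))  ≈⟨ ∙-congˡ (∙-congˡ (inverseʳ x)) ⟩
        x ∙ (y ⁻¹ ∙ ε)           ≈⟨ ∙-congˡ (identityʳ (y ⁻¹)) ⟩
        x ∙ y ⁻¹                 ≈⟨ ∙-congʳ (⁻¹-involutive x) ⟨
        (x ⁻¹) ⁻¹ ∙ y ⁻¹         ∎

module _ {a : Level} (G : CQuasiOrderedGroup a) where

  open CQuasiOrderedGroup G

  restrict : {S : Pred Carrier a} → IsSubgroup group S → CQuasiOrderedGroup a
  restrict isSub = record
    { group         = subgroup group isSub
    ; _≲_           = _≲_ on proj₁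
    ; isCQuasiOrder = record
      { isTotalPreorder = record
        { isPreorder = record
          { isEquivalence = Group.isEquivalence (subgroup group isSub)
          ; reflexive     = TP.reflexive
          ; trans         = TP.trans
          }
        ; total = λ x y → TP.total (proj₁ x) (proj₁ y)
        }
      ; C           = λ x y z → C (proj₁ x) (proj₁ y) (proj₁ z)
      ; isCRelation = record
        { C-cong  = C-cong
        ; C-swap  = λ x y z → C-swap (proj₁ x) (proj₁ y) (proj₁ z)
        ; C-asym  = λ x y z → C-asym (proj₁ x) (proj₁ y) (proj₁ z)
        ; C-split = λ x y z w → C-split (proj₁ x) (proj₁ y) (proj₁ z) (proj₁ w)
        ; C-diag  = λ x y → C-diag (proj₁ x) (proj₁ y)
        }
      ; compatible = λ x y z u v →
          compatible (proj₁ x) (proj₁ y) (proj₁ z) (proj₁ u) (proj₁ v)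
      ; ≲⇔¬C       = λ x y → ≲⇔¬C (proj₁ x) (proj₁ y)
      }
    }
    where
    module TP = IsTotalPreorder isTotalPreorder
    open IsCRelation isCRelation

  -- The quasi-order induced on G/H, given on representatives of cosets.
  Induced : Pred Carrier a → Rel Carrier a
  Induced H x y = x ∈ H ⊎ (y ∉ H × x ≲ y)

  record IsNormalConvexWithValuationalQuotient (H : Pred Carrier a) : Set (suc a) where
    field
      isNormalSubgroup    : IsNormalSubgroup group H
      convex              : Convex H
      quotientValuational : IsValuational (quotient group isNormalSubgroup) (Induced H)

  VType : Pred Carrier a
  VType g = g ∼ g ⁻¹

  O⁺Type : Pred Carrier a
  O⁺Type g = g ⁻¹ ≺ g

  T[_] : Carrier → Pred Carrier a
  T[ g ] h = VType h × ¬ (h ≈ ε) × ¬ (∃[ c ] O⁺Type c × Between c h g)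

  -- The subgroups usually written with a lower, respectively an upper, index g.
  Lower[_] : Carrier → Pred Carrier a
  Lower[ g ] h = ∀ t → t ∈ T[ g ] → h ≺ t

  Upper[_] : Carrier → Pred Carrier a
  Upper[ g ] = Lower[ g ] ∪ T[ g ]

IsSmallest : {a p : Level} {A : Set a} → (Pred A a → Set p) → Pred A a → Set (suc a Level.⊔ p)
IsSmallest P H = P H × (∀ H′ → P H′ → H ⊆ H′)

{-# OPTIONS --safe #-}
module Submission where

-- If t is v-type, then {x | x ≺ t} and {x | x ≲ t and x⁻¹ ≲ t} are subgroups: t ≺ xt or
-- t ≺ tx gives t⁻¹ ≺ x by translation, hence t ≺ x.  G_g is the intersection of the former
-- and G^g the union of the latter over t ∈ T_g, so the quasi-order on G^g/G_g is
-- ultrametric, and its classes, reversed, serve as the values of a valuation.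
-- For minimality, an element outside a normal convex subgroup with valuational quotient is
-- v-type, whereas a v-type element of G_g other than 1 is separated from g by an o⁺-type one.

open import Defs
open import Algebra.Bundles using (Group)
import Algebra.Construct.NaturalChoice.Min as Min
import Algebra.Properties.Group as GroupProperties
open import Axiom.ExcludedMiddle using (ExcludedMiddle)
open import Data.Product.Base using (Σ-syntax; ∃-syntax; _×_; _,_; proj₁; proj₂)
open import Data.Sum.Base using (_⊎_; inj₁; inj₂; [_,_]′)
open import Function.Base using (flip; _∘_)
open import Function.Bundles using (Equivalence; mk⇔)
open import Level using (Level)
open import Relation.Binary.Bundles using (TotalOrder)
open import Relation.Binary.Core using (Rel)
open import Relation.Binary.Structures using (IsTotalPreorder)
import Relation.Binary.Construct.Interior.Symmetric as SymInterior
open import Relation.Binary.Construct.Add.Supremum.Equality using (⊤⁺≈⊤⁺)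
import Relation.Binary.Construct.Add.Supremum.NonStrict as AddSup
open import Relation.Nullary.Construct.Add.Supremum using (⊤⁺; [_])
open import Relation.Nullary.Decidable.Core using (Dec; yes; no; decidable-stable)
open import Relation.Nullary.Negation.Core using (¬_; contradiction)
open import Relation.Unary using (Pred; _∈_; _∉_)

-- Conjugation in a group.

module _ {a : Level} (G : Group a a) where

  open Group G
  open GroupProperties G

  conj-cancel : ∀ x z → _^_ G (_^_ G x z) (z ⁻¹) ≈ x
  conj-cancel x z = trans (∙-congˡ (⁻¹-involutive z))
    (trans (∙-congʳ (trans (∙-congˡ (assoc z x (z ⁻¹))) (\\-leftDividesʳ z (x ∙ z ⁻¹))))
      (//-rightDividesˡ z x))

  conj-cancel′ : ∀ x z → _^_ G (_^_ G x (z ⁻¹)) z ≈ x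
  conj-cancel′ x z = trans
    (∙-cong (∙-congʳ (sym (⁻¹-involutive z))) (⁻¹-cong (sym (⁻¹-involutive z))))
    (conj-cancel x (z ⁻¹))

  conj-⁻¹ : ∀ x z → _^_ G (x ⁻¹) z ≈ (_^_ G x z) ⁻¹
  conj-⁻¹ x z = sym (trans (⁻¹-anti-homo-∙ (z ∙ x) (z ⁻¹))
    (trans (∙-cong (⁻¹-involutive z) (⁻¹-anti-homo-∙ z x)) (sym (assoc z (x ⁻¹) (z ⁻¹)))))

  conj-cong : ∀ {x y} z → x ≈ y → _^_ G x z ≈ _^_ G y z
  conj-cong z x≈y = ∙-congʳ (∙-congˡ x≈y)

-- Valuations and ultrametric quasi-orders.

module _ {a : Level} (Q : Group a a) (_≲_ : Rel (Group.Carrier Q) a) where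

  open Group Q

  module _
    (isTotalPreorder : IsTotalPreorder _≈_ _≲_)
    (ε-minimum : ∀ x → ε ≲ x)
    (≲ε⇒≈ε : ∀ {x} → x ≲ ε → x ≈ ε)
    (ultrametric : ∀ {x y m} → x ≲ m → y ≲ m → (x ∙ y ⁻¹) ≲ m)
    (conj-mono : ∀ {x y} z → x ≲ y → _^_ Q x z ≲ _^_ Q y z)
    (≈ε? : ∀ x → Dec (x ≈ ε))
    where

    private module ≲ = IsTotalPreorder isTotalPreorder

    ultrametric⇒valuational : IsValuational Q _≲_
    ultrametric⇒valuational = valuation , λ x y → mk⇔ antitone reflect
      where
      -- Equality on `Γ` is the symmetric part of `_≲_`, so equivalence classes become values
      -- without forming a quotient.
      Γ : TotalOrder a a a
      Γ = record
        { Carrier      = Carrier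
        ; _≤_          = flip _≲_
        ; isTotalOrder = record
          { isPartialOrder = SymInterior.isPartialOrder ≲.refl (flip ≲.trans)
          ; total          = flip ≲.total
          }
        }

      Γ∞ : TotalOrder a a a
      Γ∞ = record
        { isTotalOrder = AddSup.≤⁺-isTotalOrder _ (TotalOrder.isTotalOrder Γ) }

      open TotalOrder Γ∞ using (antisym; module Eq)
        renaming (Carrier to Value; _≈_ to _≈ᵥ_; _≤_ to _≤ᵥ_; trans to ≤ᵥ-trans
                 ; reflexive to ≤ᵥ-reflexive)
      open Min Γ∞ using (_⊓_; x⊓y≤x; x⊓y≤y)

      v : Carrier → Value
      v x with ≈ε? x
      ... | yes _ = ⊤⁺
      ... | no  _ = [ x ]

      antitone : ∀ {x y} → x ≲ y → v y ≤ᵥ v x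
      antitone {x} {y} x≲y with ≈ε? x | ≈ε? y
      ... | yes _   | _       = _ AddSup.≤⊤⁺
      ... | no  x≉ε | yes y≈ε = contradiction (≲ε⇒≈ε (≲.trans x≲y (≲.reflexive y≈ε))) x≉ε
      ... | no  _   | no  _   = AddSup.[ x≲y ]

      reflect : ∀ {x y} → v y ≤ᵥ v x → x ≲ y
      reflect {x} {y} vy≤vx with ≈ε? x | ≈ε? y
      reflect {x} {y} _              | yes x≈ε | _    = ≲.trans (≲.reflexive x≈ε) (ε-minimum y)
      reflect         AddSup.[ x≲y ] | no  _   | no _ = x≲y

      v≈⊤⇒≈ε : ∀ x → v x ≈ᵥ ⊤⁺ → x ≈ ε
      v≈⊤⇒≈ε x vx≈⊤ = ≲ε⇒≈ε (reflect (≤ᵥ-trans (_ AddSup.≤⊤⁺) (≤ᵥ-reflexive (Eq.sym vx≈⊤))))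

      ≈ε⇒v≈⊤ : ∀ x → x ≈ ε → v x ≈ᵥ ⊤⁺
      ≈ε⇒v≈⊤ x x≈ε with ≈ε? x
      ... | yes _   = ⊤⁺≈⊤⁺
      ... | no  x≉ε = contradiction x≈ε x≉ε

      v-ultra : ∀ x y → (v x ⊓ v y) ≤ᵥ v (x ∙ y ⁻¹)
      v-ultra x y with ≲.total x y
      ... | inj₁ x≲y = ≤ᵥ-trans (x⊓y≤y (v x) (v y)) (antitone (ultrametric x≲y ≲.refl))
      ... | inj₂ y≲x = ≤ᵥ-trans (x⊓y≤x (v x) (v y)) (antitone (ultrametric ≲.refl y≲x))

      conj-reflect : ∀ {x y} z → _^_ Q x z ≲ _^_ Q y z → x ≲ y
      conj-reflect {x} {y} z xᶻ≲yᶻ = ≲.trans (≲.reflexive (sym (conj-cancel Q x z)))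
        (≲.trans (conj-mono (z ⁻¹) xᶻ≲yᶻ) (≲.reflexive (conj-cancel Q y z)))

      valuation : Valuation Q
      valuation = record
        { Γ       = Γ
        ; v       = v
        ; v-cong  = λ x≈y → antisym (antitone (≲.reflexive (sym x≈y))) (antitone (≲.reflexive x≈y))
        ; v-∞     = λ x → mk⇔ (v≈⊤⇒≈ε x) (≈ε⇒v≈⊤ x)
        ; v-ultra = v-ultra
        ; v-conj  = λ x y z → mk⇔
            (antitone ∘ conj-mono z ∘ reflect)
            (antitone ∘ conj-reflect z ∘ reflect)
        }

  -- Since v(ε) = ∞, the ultrametric inequality for `ε ∙ x ⁻¹` reads v(x) ≤ v(x⁻¹). This is what
  -- excludes o⁺-type elements from a valuational quotient.
  valuational⇒⁻¹-mono : IsValuational Q _≲_ → ∀ x → (x ⁻¹) ≲ x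
  valuational⇒⁻¹-mono (valuation , ≲⇔≥ᵥ) x =
    Equivalence.from (≲⇔≥ᵥ (x ⁻¹) x)
      (≤ᵥ-trans (≤ᵥ-reflexive (Eq.sym (x≤y⇒y⊓x≈x vx≤vε)))
        (≤ᵥ-trans (v-ultra ε x) (≤ᵥ-reflexive (v-cong (identityˡ (x ⁻¹))))))
    where
    open Valuation valuation
    open TotalOrder Γ∞ using (module Eq) renaming (trans to ≤ᵥ-trans; reflexive to ≤ᵥ-reflexive)
    open Min Γ∞ using (x≤y⇒y⊓x≈x)

    vx≤vε : v x ≤ᵥ v ε
    vx≤vε = ≤ᵥ-trans (_ AddSup.≤⊤⁺) (≤ᵥ-reflexive (Eq.sym (Equivalence.from (v-∞ ε) refl)))

-- Strict order and translations in a C-quasi-ordered group.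

module _ {a : Level} (em : ExcludedMiddle a) (G : CQuasiOrderedGroup a) where

  open CQuasiOrderedGroup G
  open IsCRelation isCRelation
  open GroupProperties group

  private module ≲ = IsTotalPreorder isTotalPreorder

  -- `_≲_` is given only as a negation of `C`, so recovering `C` takes excluded middle. Strict
  -- inequalities are then instances of `C`, on which translations act.
  ≺⇒C : ∀ {x y} → x ≺ y → C y x ε
  ≺⇒C {x} {y} (x≲y , x≁y) = decidable-stable em
    (λ ¬C → x≁y (x≲y , Equivalence.from (≲⇔¬C y x) ¬C))

  C⇒≺ : ∀ {x y} → C y x ε → x ≺ y
  C⇒≺ {x} {y} c = Equivalence.from (≲⇔¬C x y) (C-asym y x ε c)
                , λ (_ , y≲x) → Equivalence.to (≲⇔¬C y x) y≲x c

  ≺⇒⋧ : ∀ {x y} → x ≺ y → ¬ (y ≲ x)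
  ≺⇒⋧ (x≲y , x≁y) y≲x = x≁y (x≲y , y≲x)

  ≲-≺-trans : ∀ {x y z} → x ≲ y → y ≺ z → x ≺ z
  ≲-≺-trans x≲y y≺z@(y≲z , _) = ≲.trans x≲y y≲z , λ (_ , z≲x) → ≺⇒⋧ y≺z (≲.trans z≲x x≲y)

  ≺-≲-trans : ∀ {x y z} → x ≺ y → y ≲ z → x ≺ z
  ≺-≲-trans x≺y@(x≲y , _) y≲z = ≲.trans x≲y y≲z , λ (_ , z≲x) → ≺⇒⋧ x≺y (≲.trans y≲z z≲x)

  ≺-irrefl : ∀ {x} → ¬ (x ≺ x)
  ≺-irrefl x≺x = ≺⇒⋧ x≺x ≲.refl

  ≺-or-≳ : ∀ x y → x ≺ y ⊎ y ≲ x
  ≺-or-≳ x y with em {y ≲ x} | ≲.total x y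
  ... | yes y≲x | _        = inj₂ y≲x
  ... | no  _   | inj₂ y≲x = inj₂ y≲x
  ... | no  y⋦x | inj₁ x≲y = inj₁ (x≲y , y⋦x ∘ proj₂)

  ⊀⇒≳ : ∀ {x y} → ¬ (x ≺ y) → y ≲ x
  ⊀⇒≳ {x} {y} x⊀y = [ (λ x≺y → contradiction x≺y x⊀y) , (λ y≲x → y≲x) ]′ (≺-or-≳ x y)

  ε≺ : ∀ {x} → ¬ (x ≈ ε) → ε ≺ x
  ε≺ {x} x≉ε = C⇒≺ (C-diag x ε x≉ε)

  -- Swapping turns `C ε x ε` into `C ε ε x`, which asymmetry forbids because its first two
  -- arguments coincide.
  ε≲ : ∀ x → ε ≲ x
  ε≲ x = Equivalence.from (≲⇔¬C ε x)
    (λ c → C-asym ε ε x (C-swap ε x ε c) (C-swap ε x ε c))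

  C-shiftˡ : ∀ v {x y z} → C x y z → C (v ∙ x) (v ∙ y) (v ∙ z)
  C-shiftˡ v c = C-cong (identityʳ _) (identityʳ _) (identityʳ _) (compatible _ _ _ ε v c)

  C-shiftʳ : ∀ u {x y z} → C x y z → C (x ∙ u) (y ∙ u) (z ∙ u)
  C-shiftʳ u c =
    C-cong (εx∙ _) (εx∙ _) (εx∙ _) (compatible _ _ _ u ε c)
    where
    εx∙ : ∀ x → ε ∙ x ∙ u ≈ x ∙ u
    εx∙ x = ∙-congʳ (identityˡ x)

  -- Read `C x y w` as: `y` and `w` stay together while `x` branches off. Splitting both hypotheses
  -- leaves one bad case, `C z w y` with `C y w z`, which asymmetry excludes.
  C-trans : ∀ {x y z w} → C x y w → C x z w → C x y z
  C-trans {x} {y} {z} {w} cy cz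
    with C-split x w y z (C-swap x y w cy) | C-split x w z y (C-swap x z w cz)
  ... | inj₂ c  | _       = C-swap x z y c
  ... | inj₁ _  | inj₂ c  = c
  ... | inj₁ c  | inj₁ c′ = contradiction (C-swap y w z c′) (C-asym z y w (C-swap z w y c))

  -- Multiplying `C y x ε` by `x ⁻¹` sends `x` to `ε` and `ε` to `x ⁻¹`, so these two trade places.
  ≺-shiftˡ : ∀ {x y} → x ≺ y → x ⁻¹ ≺ x ⁻¹ ∙ y
  ≺-shiftˡ {x} x≺y = C⇒≺ (C-swap _ _ _
    (C-cong refl (inverseˡ x) (identityʳ _) (C-shiftˡ (x ⁻¹) (≺⇒C x≺y))))

  ≺-shiftʳ : ∀ {x y} → x ≺ y → x ⁻¹ ≺ y ∙ x ⁻¹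
  ≺-shiftʳ {x} x≺y = C⇒≺ (C-swap _ _ _
    (C-cong refl (inverseʳ x) (identityˡ _) (C-shiftʳ (x ⁻¹) (≺⇒C x≺y))))

  ≺-resp : ∀ {x x′ y y′} → x ≈ x′ → y ≈ y′ → x ≺ y → x′ ≺ y′
  ≺-resp x≈x′ y≈y′ x≺y =
    ≲-≺-trans (≲.reflexive (sym x≈x′)) (≺-≲-trans x≺y (≲.reflexive y≈y′))

  infixl 9 _^ᴳ_
  _^ᴳ_ = _^_ group

  ≺-conj : ∀ {x y} z → x ≺ y → x ^ᴳ z ≺ y ^ᴳ z
  ≺-conj z x≺y = C⇒≺ (C-cong refl refl (trans (∙-congʳ (identityʳ z)) (inverseʳ z))
    (compatible _ _ _ (z ⁻¹) z (≺⇒C x≺y)))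

  ≲-conj : ∀ {x y} z → x ≲ y → x ^ᴳ z ≲ y ^ᴳ z
  ≲-conj {x} {y} z x≲y = ⊀⇒≳ (λ yᶻ≺xᶻ → ≺⇒⋧
    (≺-resp (conj-cancel group y z) (conj-cancel group x z) (≺-conj (z ⁻¹) yᶻ≺xᶻ)) x≲y)

  VType-conj : ∀ {x} z → VType G x → VType G (x ^ᴳ z)
  VType-conj {x} z (x≲x⁻¹ , x⁻¹≲x) =
    ≲.trans (≲-conj z x≲x⁻¹) (≲.reflexive (conj-⁻¹ group x z)) ,
    ≲.trans (≲.reflexive (sym (conj-⁻¹ group x z))) (≲-conj z x⁻¹≲x)

  O⁺Type-conj : ∀ {x} z → O⁺Type G x → O⁺Type G (x ^ᴳ z)
  O⁺Type-conj {x} z x⁻¹≺x = ≺-resp (conj-⁻¹ group x z) refl (≺-conj z x⁻¹≺x)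

  -- Balls whose radius is a v-type element.

  VType⇒∙-absorbˡ : ∀ {t x} → VType G t → t ≺ x ∙ t → t ≺ x
  VType⇒∙-absorbˡ {t} {x} (t≲t⁻¹ , _) t≺xt =
    ≲-≺-trans t≲t⁻¹ (≺-resp refl (//-rightDividesʳ t x) (≺-shiftʳ t≺xt))

  VType⇒∙-absorbʳ : ∀ {t x} → VType G t → t ≺ t ∙ x → t ≺ x
  VType⇒∙-absorbʳ {t} {x} (t≲t⁻¹ , _) t≺tx =
    ≲-≺-trans t≲t⁻¹ (≺-resp refl (\\-leftDividesʳ t x) (≺-shiftˡ t≺tx))

  -- If `t ∼ c`, translating `c ⁻¹ ≺ t` by `c` gives `t ≲ c ≺ t ∙ c`, and absorption yields `t ≺ c`.
  VType⇒≁O⁺Type : ∀ {t c} → VType G t → O⁺Type G c → ¬ (t ∼ c)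
  VType⇒≁O⁺Type {t} {c} vt c⁻¹≺c (t≲c , c≲t) =
    ≺⇒⋧ (VType⇒∙-absorbʳ vt t≺tc) c≲t
    where
    t≺tc : t ≺ t ∙ c
    t≺tc = ≲-≺-trans t≲c (≺-resp (⁻¹-involutive c) (∙-congˡ (⁻¹-involutive c))
      (≺-shiftʳ (≺-≲-trans c⁻¹≺c c≲t)))

  -- Suppose `t ≲ c`, where `c` is `x ⁻¹`. Translating `x ≺ t ≲ t ⁻¹` gives `c ≺ t ∙ c` and
  -- `c ≺ t ⁻¹ ∙ c`. Absorption turns the first into `t ≺ c`; its translate by `t ⁻¹` is
  -- `C c (t ⁻¹ ∙ c) (t ⁻¹)`, and as `t ⁻¹ ≺ c` this forces `t ⁻¹ ∙ c ≺ c`, against the second.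
  ≺VType⇒⁻¹≺ : ∀ {t x} → VType G t → x ≺ t → x ⁻¹ ≺ t
  ≺VType⇒⁻¹≺ {t} {x} vt@(t≲t⁻¹ , t⁻¹≲t) x≺t =
    [ (λ x⁻¹≺t → x⁻¹≺t) , (λ t≲c → contradiction (proj₁ c≺t⁻¹c) (≺⇒⋧ (t⁻¹c≺c t≲c))) ]′
      (≺-or-≳ (x ⁻¹) t)
    where
    c = x ⁻¹

    c≺tc : c ≺ t ∙ c
    c≺tc = ≺-shiftʳ x≺t

    c≺t⁻¹c : c ≺ t ⁻¹ ∙ c
    c≺t⁻¹c = ≺-shiftʳ (≺-≲-trans x≺t t≲t⁻¹)

    t⁻¹c≺c : t ≲ c → t ⁻¹ ∙ c ≺ c
    t⁻¹c≺c t≲c = C⇒≺ (C-trans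
      (C-cong (\\-leftDividesʳ t c) refl (identityʳ (t ⁻¹)) (C-shiftˡ (t ⁻¹) (≺⇒C c≺tc)))
      (C-swap _ _ _ (≺⇒C (≲-≺-trans t⁻¹≲t (VType⇒∙-absorbʳ vt (≲-≺-trans t≲c c≺tc))))))

  -- Both `y` and `x ⁻¹` are strictly below `t`, so `C t y (x ⁻¹)`; translating by `x` gives
  -- `x ∙ y ≺ x ∙ t`. Then `t ≲ x ∙ y` would be absorbed into `t ≺ x`.
  ∙-closed-≺VType : ∀ {t x y} → VType G t → x ≺ t → y ≺ t → x ∙ y ≺ t
  ∙-closed-≺VType {t} {x} {y} vt x≺t y≺t =
    [ (λ xy≺t → xy≺t)
    , (λ t≲xy → contradiction (proj₁ x≺t) (≺⇒⋧ (VType⇒∙-absorbˡ vt (≲-≺-trans t≲xy xy≺xt))))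
    ]′ (≺-or-≳ (x ∙ y) t)
    where
    xy≺xt : x ∙ y ≺ x ∙ t
    xy≺xt = C⇒≺ (C-cong refl refl (inverseʳ x)
      (C-shiftˡ x (C-trans (≺⇒C y≺t) (≺⇒C (≺VType⇒⁻¹≺ vt x≺t)))))

  -- A symmetric closed ball about `ε`. The inverse is bounded separately because `≺VType⇒⁻¹≺`
  -- transfers only strict bounds.
  Bounded[_] : Carrier → Pred Carrier a
  Bounded[ t ] x = x ≲ t × x ⁻¹ ≲ t

  Bounded-⁻¹ : ∀ {t x} → x ∈ Bounded[ t ] → x ⁻¹ ∈ Bounded[ t ]
  Bounded-⁻¹ {t} {x} (x≲t , x⁻¹≲t) = x⁻¹≲t , ≲.trans (≲.reflexive (⁻¹-involutive x)) x≲t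

  Bounded-weaken : ∀ {s t x} → s ≲ t → x ∈ Bounded[ s ] → x ∈ Bounded[ t ]
  Bounded-weaken s≲t (x≲s , x⁻¹≲s) = ≲.trans x≲s s≲t , ≲.trans x⁻¹≲s s≲t

  -- If `x ⁻¹ ≺ t`, inverting again would give `x ≺ t`. Such an `x` can replace `t` in the
  -- absorption lemmas.
  Bounded-≳⇒VType : ∀ {t x} → VType G t → x ∈ Bounded[ t ] → t ≲ x → VType G x
  Bounded-≳⇒VType {t} {x} vt (x≲t , x⁻¹≲t) t≲x = ≲.trans x≲t t≲x⁻¹ , ≲.trans x⁻¹≲t t≲x
    where
    t≲x⁻¹ : t ≲ x ⁻¹
    t≲x⁻¹ = ⊀⇒≳ (λ x⁻¹≺t → ≺⇒⋧
      (≺-resp (⁻¹-involutive x) refl (≺VType⇒⁻¹≺ vt x⁻¹≺t)) t≲x)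

  -- A factor on the boundary of the ball is itself v-type and absorbs: `x ≺ x ∙ y` would give
  -- `x ≺ y`, although `y ≲ t ≲ x`.
  Bounded⇒∙≲ : ∀ {t x y} → VType G t → x ∈ Bounded[ t ] → y ∈ Bounded[ t ] → x ∙ y ≲ t
  Bounded⇒∙≲ {t} {x} {y} vt bx by with ≺-or-≳ x t | ≺-or-≳ y t
  ... | inj₁ x≺t | inj₁ y≺t = proj₁ (∙-closed-≺VType vt x≺t y≺t)
  ... | inj₂ t≲x | _        = ≲.trans (⊀⇒≳ (λ x≺xy → ≺⇒⋧
    (VType⇒∙-absorbʳ (Bounded-≳⇒VType vt bx t≲x) x≺xy) (≲.trans (proj₁ by) t≲x))) (proj₁ bx)
  ... | inj₁ _   | inj₂ t≲y = ≲.trans (⊀⇒≳ (λ y≺xy → ≺⇒⋧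
    (VType⇒∙-absorbˡ (Bounded-≳⇒VType vt by t≲y) y≺xy) (≲.trans (proj₁ bx) t≲y))) (proj₁ by)

  Bounded-∙ : ∀ {t x y} → VType G t →
    x ∈ Bounded[ t ] → y ∈ Bounded[ t ] → x ∙ y ∈ Bounded[ t ]
  Bounded-∙ {t} {x} {y} vt bx by = Bounded⇒∙≲ vt bx by
    , ≲.trans (≲.reflexive (⁻¹-anti-homo-∙ x y)) (Bounded⇒∙≲ vt (Bounded-⁻¹ by) (Bounded-⁻¹ bx))

  VType⇒Bounded : ∀ {t x} → VType G x → x ≲ t → x ∈ Bounded[ t ]
  VType⇒Bounded (_ , x⁻¹≲x) x≲t = x≲t , ≲.trans x⁻¹≲x x≲t

  -- The subgroups `L` and `U` attached to `g`.

  module _ (g : Carrier) (g≉ε : ¬ (g ≈ ε)) (vg : VType G g) where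

    T L U : Pred Carrier a
    T = T[_] G g
    L = Lower[_] G g
    U = Upper[_] G g

    g∈T : g ∈ T
    g∈T = vg , g≉ε ,
      λ { (c , o , inj₁ g≲c≲g) → VType⇒≁O⁺Type vg o g≲c≲g
        ; (c , o , inj₂ g≲c≲g) → VType⇒≁O⁺Type vg o g≲c≲g }

    T⇒VType : ∀ {t} → t ∈ T → VType G t
    T⇒VType = proj₁

    -- Membership in `T` compares with `g` alone, but on whichever side of `g` it falls, `c` lies
    -- between `g` and one of `s`, `t`.
    no-O⁺Type-between : ∀ {s t c} → s ∈ T → t ∈ T → O⁺Type G c → s ≲ c → ¬ (c ≲ t)
    no-O⁺Type-between {c = c} (_ , _ , ¬btw-s) (_ , _ , ¬btw-t) o s≲c c≲t with ≲.total c g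
    ... | inj₁ c≲g = ¬btw-s (c , o , inj₁ (s≲c , c≲g))
    ... | inj₂ g≲c = ¬btw-t (c , o , inj₂ (g≲c , c≲t))

    T-convex : ∀ {s t x} → VType G x → s ∈ T → t ∈ T → s ≲ x → x ≲ t → x ∈ T
    T-convex {s} {t} {x} vx s∈T t∈T s≲x x≲t = vx
      , (λ x≈ε → ≺⇒⋧ (ε≺ (proj₁ (proj₂ s∈T))) (≲.trans s≲x (≲.reflexive x≈ε)))
      , λ { (c , o , inj₁ (x≲c , c≲g)) → no-O⁺Type-between s∈T g∈T o (≲.trans s≲x x≲c) c≲g
          ; (c , o , inj₂ (g≲c , c≲x)) → no-O⁺Type-between g∈T t∈T o g≲c (≲.trans c≲x x≲t) }

    L⇒∉T : ∀ {x} → x ∈ L → x ∉ T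
    L⇒∉T x∈L x∈T = ≺-irrefl (x∈L _ x∈T)

    ∉L⇒T : ∀ {x} → x ∈ U → x ∉ L → x ∈ T
    ∉L⇒T (inj₁ x∈L) x∉L = contradiction x∈L x∉L
    ∉L⇒T (inj₂ x∈T) _   = x∈T

    -- With `U⇒Bounded`, this exhibits `U` as the union of the balls with radius in `T`. If some `s`
    -- in `T` is below `x`, it is below `x ⁻¹` too; an o⁺-type `x` or `x ⁻¹` would then sit between
    -- members of `T`, so `x` is v-type.
    Bounded⇒U : ∀ {t x} → t ∈ T → x ∈ Bounded[ t ] → x ∈ U
    Bounded⇒U {t} {x} t∈T (x≲t , x⁻¹≲t) with em {∃[ s ] s ∈ T × s ≲ x}
    ... | no  ∄s = inj₁ (λ s s∈T → [ (λ x≺s → x≺s) , (λ s≲x → contradiction (s , s∈T , s≲x) ∄s) ]′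
                                     (≺-or-≳ x s))
    ... | yes (s , s∈T , s≲x) = inj₂ (T-convex (x≲x⁻¹ , x⁻¹≲x) s∈T t∈T s≲x x≲t)
      where
      s≲x⁻¹ : s ≲ x ⁻¹
      s≲x⁻¹ = ⊀⇒≳ (λ x⁻¹≺s → ≺⇒⋧
        (≺-resp (⁻¹-involutive x) refl (≺VType⇒⁻¹≺ (T⇒VType s∈T) x⁻¹≺s)) s≲x)

      x≲x⁻¹ : x ≲ x ⁻¹
      x≲x⁻¹ = ⊀⇒≳ (λ x⁻¹≺x → no-O⁺Type-between s∈T t∈T x⁻¹≺x s≲x x≲t)

      x⁻¹≲x : x ⁻¹ ≲ x
      x⁻¹≲x = ⊀⇒≳ (λ x≺x⁻¹ → no-O⁺Type-between s∈T t∈T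
        (≺-resp (sym (⁻¹-involutive x)) refl x≺x⁻¹) s≲x⁻¹ x⁻¹≲t)

    L⇒≺ : ∀ {x t} → x ∈ L → t ∈ T → x ≺ t
    L⇒≺ x∈L = x∈L _

    L⇒Bounded : ∀ {x t} → x ∈ L → t ∈ T → x ∈ Bounded[ t ]
    L⇒Bounded x∈L t∈T = proj₁ (L⇒≺ x∈L t∈T) , proj₁ (≺VType⇒⁻¹≺ (T⇒VType t∈T) (L⇒≺ x∈L t∈T))

    U⇒Bounded : ∀ {x} → x ∈ U → ∃[ t ] t ∈ T × x ∈ Bounded[ t ]
    U⇒Bounded (inj₁ x∈L) = g , g∈T , L⇒Bounded x∈L g∈T
    U⇒Bounded (inj₂ x∈T) = _ , x∈T , VType⇒Bounded (T⇒VType x∈T) ≲.refl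

    -- Members of `U` are strictly below all of `T` or v-type; either way the bound on the inverse
    -- is automatic.
    U-≲⇒Bounded : ∀ {x t} → x ∈ U → t ∈ T → x ≲ t → x ∈ Bounded[ t ]
    U-≲⇒Bounded (inj₁ x∈L) t∈T _   = L⇒Bounded x∈L t∈T
    U-≲⇒Bounded (inj₂ x∈T) _   x≲t = VType⇒Bounded (T⇒VType x∈T) x≲t

    U-isSubgroup : IsSubgroup group U
    U-isSubgroup = record
      { resp      = λ x≈y x∈U → let t , t∈T , x≲t , x⁻¹≲t = U⇒Bounded x∈U in
          Bounded⇒U t∈T (≲.trans (≲.reflexive (sym x≈y)) x≲t
                        , ≲.trans (≲.reflexive (⁻¹-cong (sym x≈y))) x⁻¹≲t)
      ; ε-closed  = inj₁ λ _ (_ , t≉ε , _) → ε≺ t≉ε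
      ; ∙-closed  = ∙-closed
      ; ⁻¹-closed = λ x∈U → let t , t∈T , bx = U⇒Bounded x∈U in Bounded⇒U t∈T (Bounded-⁻¹ bx)
      }
      where
      ∙-closed : ∀ {x y} → x ∈ U → y ∈ U → x ∙ y ∈ U
      ∙-closed x∈U y∈U with U⇒Bounded x∈U | U⇒Bounded y∈U
      -- The balls are nested, so the larger radius serves both factors.
      ... | s , s∈T , bx | t , t∈T , by with ≲.total s t
      ... | inj₁ s≲t = Bounded⇒U t∈T (Bounded-∙ (T⇒VType t∈T) (Bounded-weaken s≲t bx) by)
      ... | inj₂ t≲s = Bounded⇒U s∈T (Bounded-∙ (T⇒VType s∈T) bx (Bounded-weaken t≲s by))

    open IsSubgroup U-isSubgroup

    U-conj : ∀ {x z} → x ∈ U → z ∈ U → x ^ᴳ z ∈ U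
    U-conj x∈U z∈U = ∙-closed (∙-closed z∈U x∈U) (⁻¹-closed z∈U)

    -- If tᶻ dropped below T, an o⁺-type element would separate it from g, and its
    -- conjugate by z⁻¹ would be an o⁺-type element between two elements of T.
    T-conj : ∀ {t z} → t ∈ T → z ∈ U → t ^ᴳ z ∈ T
    T-conj {t} {z} t∈T@(vt , t≉ε , _) z∈U = vtᶻ , tᶻ≉ε , λ where
        (c , o , inj₂ (g≲c , c≲tᶻ)) →
          [ (λ tᶻ∈L → ≺⇒⋧ (L⇒≺ tᶻ∈L g∈T) (≲.trans g≲c c≲tᶻ))
          , (λ tᶻ∈T → no-O⁺Type-between g∈T tᶻ∈T o g≲c c≲tᶻ) ]′ tᶻ∈U
        (c , o , inj₁ (tᶻ≲c , c≲g)) → no-O⁺Type-between t∈T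
          (g′∈T (≲.trans tᶻ≲c c≲g)) (O⁺Type-conj (z ⁻¹) o)
          (≲.trans t≲tᶻ′ (≲-conj (z ⁻¹) tᶻ≲c)) (≲-conj (z ⁻¹) c≲g)
      where
      vtᶻ : VType G (t ^ᴳ z)
      vtᶻ = VType-conj z vt

      tᶻ∈U : t ^ᴳ z ∈ U
      tᶻ∈U = U-conj (inj₂ t∈T) z∈U

      t≲tᶻ′ : t ≲ (t ^ᴳ z) ^ᴳ (z ⁻¹)
      t≲tᶻ′ = ≲.reflexive (sym (conj-cancel group t z))

      tᶻ≉ε : ¬ (t ^ᴳ z ≈ ε)
      tᶻ≉ε tᶻ≈ε = t≉ε (trans (sym (conj-cancel group t z)) (trans (conj-cong group (z ⁻¹) tᶻ≈ε)
        (trans (∙-congʳ (identityʳ _)) (inverseʳ _))))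

      g′∈T : t ^ᴳ z ≲ g → g ^ᴳ (z ⁻¹) ∈ T
      g′∈T tᶻ≲g = ∉L⇒T (U-conj (inj₂ g∈T) (⁻¹-closed z∈U))
        (λ g′∈L → ≺⇒⋧ (L⇒≺ g′∈L t∈T) (≲.trans t≲tᶻ′ (≲-conj (z ⁻¹) tᶻ≲g)))

    -- The conjugate of `t` by `z ⁻¹` stays in `T`; conjugating its comparison with `x` by `z` gives
    -- the one with `t`.
    L-conj : ∀ {x z} → x ∈ L → z ∈ U → x ^ᴳ z ∈ L
    L-conj {x} {z} x∈L z∈U t t∈T = ≺-resp refl (conj-cancel′ group t z)
      (≺-conj z (L⇒≺ x∈L (T-conj t∈T (⁻¹-closed z∈U))))

    -- The quotient of `U` by `L`.

    Gᵍ : CQuasiOrderedGroup a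
    Gᵍ = restrict G U-isSubgroup

    private module Gᵍ = CQuasiOrderedGroup Gᵍ

    L⟨Gᵍ⟩ : Pred Gᵍ.Carrier a
    L⟨Gᵍ⟩ (x , _) = x ∈ L

    L-isNormal : IsNormalSubgroup Gᵍ.group L⟨Gᵍ⟩
    L-isNormal = record
      { isSubgroup  = record
        { resp      = λ x≈y x∈L t t∈T → ≺-resp x≈y refl (L⇒≺ x∈L t∈T)
        ; ε-closed  = λ _ (_ , t≉ε , _) → ε≺ t≉ε
        ; ∙-closed  = λ x∈L y∈L t t∈T → ∙-closed-≺VType (T⇒VType t∈T) (L⇒≺ x∈L t∈T) (L⇒≺ y∈L t∈T)
        ; ⁻¹-closed = λ x∈L t t∈T → ≺VType⇒⁻¹≺ (T⇒VType t∈T) (L⇒≺ x∈L t∈T)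
        }
      ; conj-closed = λ (_ , z∈U) x∈L → L-conj x∈L z∈U
      }

    private module L = IsNormalSubgroup L-isNormal

    Gᵍ/L : Group a a
    Gᵍ/L = quotient Gᵍ.group L-isNormal

    private module Gᵍ/L = Group Gᵍ/L

    infix 4 _≲ᴸ_
    _≲ᴸ_ : Rel Gᵍ.Carrier a
    _≲ᴸ_ = Induced Gᵍ L⟨Gᵍ⟩

    ≲ᴸ⇒L : ∀ {x y} → x ≲ᴸ y → y ∈ L⟨Gᵍ⟩ → x ∈ L⟨Gᵍ⟩
    ≲ᴸ⇒L (inj₁ x∈L)       _   = x∈L
    ≲ᴸ⇒L (inj₂ (y∉L , _)) y∈L = contradiction y∈L y∉L

    -- If `y` is outside `L` it lies in `T`, hence above all of `L`, so the first disjunct also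
    -- yields an inequality.
    ≲ᴸ⇒≲ : ∀ {x y} → x ≲ᴸ y → y ∉ L⟨Gᵍ⟩ → x Gᵍ.≲ y
    ≲ᴸ⇒≲ {y = _ , y∈U} (inj₁ x∈L)       y∉L = proj₁ (L⇒≺ x∈L (∉L⇒T y∈U y∉L))
    ≲ᴸ⇒≲               (inj₂ (_ , x≲y)) _   = x≲y

    ≲ᴸ-intro : ∀ {x y} → (y ∈ L⟨Gᵍ⟩ → x ∈ L⟨Gᵍ⟩) → (y ∉ L⟨Gᵍ⟩ → x Gᵍ.≲ y) → x ≲ᴸ y
    ≲ᴸ-intro {x} {y} L⇒L ≲-off with em {y ∈ L⟨Gᵍ⟩}
    ... | yes y∈L = inj₁ (L⇒L y∈L)
    ... | no  y∉L = inj₂ (y∉L , ≲-off y∉L)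

    ≲ᴸ-isTotalPreorder : IsTotalPreorder Gᵍ/L._≈_ _≲ᴸ_
    ≲ᴸ-isTotalPreorder = record
      { isPreorder = record
        { isEquivalence = Gᵍ/L.isEquivalence
        ; reflexive     = λ {x} {y} → reflexive′ {x} {y}
        ; trans         = λ {x} {y} {z} x≲y y≲z → ≲ᴸ-intro {x} {z}
            (≲ᴸ⇒L {x} {y} x≲y ∘ ≲ᴸ⇒L {y} {z} y≲z) (trans′ {x} {y} {z} x≲y y≲z)
        }
      ; total = total
      }
      where
      -- Independence of representatives: `x` is `y` times an element of `L`, and if `y` is in `T`
      -- both factors lie in the ball of radius `y`.
      reflexive′ : ∀ {x y} → x Gᵍ/L.≈ y → x ≲ᴸ y
      reflexive′ {x} {y} x⁻¹y∈L = ≲ᴸ-intro {x} {y}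
        (λ y∈L → L.resp {y Gᵍ.∙ (x Gᵍ.⁻¹ Gᵍ.∙ y) Gᵍ.⁻¹} {x} y[x⁻¹y]⁻¹≈x
          (L.∙-closed {y} {(x Gᵍ.⁻¹ Gᵍ.∙ y) Gᵍ.⁻¹} y∈L (L.⁻¹-closed {x Gᵍ.⁻¹ Gᵍ.∙ y} x⁻¹y∈L)))
        (λ y∉L → let y∈T = ∉L⇒T (proj₂ y) y∉L in ≲.trans (≲.reflexive (sym y[x⁻¹y]⁻¹≈x))
          (Bounded⇒∙≲ (T⇒VType y∈T) (VType⇒Bounded (T⇒VType y∈T) ≲.refl)
            (Bounded-⁻¹ (L⇒Bounded x⁻¹y∈L y∈T))))
        where
        y[x⁻¹y]⁻¹≈x : y Gᵍ.∙ (x Gᵍ.⁻¹ Gᵍ.∙ y) Gᵍ.⁻¹ Gᵍ.≈ x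
        y[x⁻¹y]⁻¹≈x = trans
          (∙-congˡ (trans (⁻¹-anti-homo-∙ _ _) (∙-congˡ (⁻¹-involutive _)))) (\\-leftDividesˡ _ _)

      trans′ : ∀ {x y z} → x ≲ᴸ y → y ≲ᴸ z → z ∉ L⟨Gᵍ⟩ → x Gᵍ.≲ z
      trans′ {x} {y} {z} x≲y y≲z z∉L with em {y ∈ L⟨Gᵍ⟩}
      ... | yes y∈L = ≲ᴸ⇒≲ {x} {z} (inj₁ (≲ᴸ⇒L {x} {y} x≲y y∈L)) z∉L
      ... | no  y∉L = ≲.trans (≲ᴸ⇒≲ {x} {y} x≲y y∉L) (≲ᴸ⇒≲ {y} {z} y≲z z∉L)

      total : ∀ x y → x ≲ᴸ y ⊎ y ≲ᴸ x
      total x y with em {x ∈ L⟨Gᵍ⟩} | em {y ∈ L⟨Gᵍ⟩} | ≲.total (proj₁ x) (proj₁ y)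
      ... | yes x∈L | _       | _        = inj₁ (inj₁ x∈L)
      ... | no  _   | yes y∈L | _        = inj₂ (inj₁ y∈L)
      ... | no  _   | no  y∉L | inj₁ x≲y = inj₁ (inj₂ (y∉L , x≲y))
      ... | no  x∉L | no  _   | inj₂ y≲x = inj₂ (inj₂ (x∉L , y≲x))

    -- If `m` is outside `L` it belongs to `T`, and the claim becomes closure of the ball of radius
    -- `m`.
    ≲ᴸ-ultrametric : ∀ {x y m} → x ≲ᴸ m → y ≲ᴸ m → (x Gᵍ.∙ y Gᵍ.⁻¹) ≲ᴸ m
    ≲ᴸ-ultrametric {x} {y} {m} x≲m y≲m = ≲ᴸ-intro {x Gᵍ.∙ y Gᵍ.⁻¹} {m}
      (λ m∈L → L.∙-closed {x} {y Gᵍ.⁻¹} (≲ᴸ⇒L {x} {m} x≲m m∈L)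
        (L.⁻¹-closed {y} (≲ᴸ⇒L {y} {m} y≲m m∈L)))
      (λ m∉L → let m∈T = ∉L⇒T (proj₂ m) m∉L in Bounded⇒∙≲ (T⇒VType m∈T)
        (U-≲⇒Bounded (proj₂ x) m∈T (≲ᴸ⇒≲ {x} {m} x≲m m∉L))
        (Bounded-⁻¹ (U-≲⇒Bounded (proj₂ y) m∈T (≲ᴸ⇒≲ {y} {m} y≲m m∉L))))

    ≲ᴸ-conj : ∀ {x y} z → x ≲ᴸ y → _^_ Gᵍ.group x z ≲ᴸ _^_ Gᵍ.group y z
    ≲ᴸ-conj {x} z (inj₁ x∈L) = inj₁ (L.conj-closed {x} z x∈L)
    ≲ᴸ-conj {x} {y} z (inj₂ (y∉L , x≲y)) = inj₂
      ( (λ yᶻ∈L → y∉L (L.resp {_^_ Gᵍ.group (_^_ Gᵍ.group y z) (z Gᵍ.⁻¹)} {y}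
          (conj-cancel group (proj₁ y) (proj₁ z))
          (L.conj-closed {_^_ Gᵍ.group y z} (z Gᵍ.⁻¹) yᶻ∈L)))
      , ≲-conj (proj₁ z) x≲y )

    L⇒≈ᴸε : ∀ {x} → x ∈ L⟨Gᵍ⟩ → x Gᵍ/L.≈ Gᵍ/L.ε
    L⇒≈ᴸε {x} x∈L =
      L.resp {x Gᵍ.⁻¹} {x Gᵍ.⁻¹ Gᵍ.∙ Gᵍ.ε} (sym (identityʳ _)) (L.⁻¹-closed {x} x∈L)

    Gᵍ/L-valuational : IsValuational Gᵍ/L _≲ᴸ_
    Gᵍ/L-valuational = ultrametric⇒valuational Gᵍ/L _≲ᴸ_ ≲ᴸ-isTotalPreorder
      (λ _ → inj₁ L.ε-closed)
      (λ {x} x≲ε → L⇒≈ᴸε {x} (≲ᴸ⇒L {x} {Gᵍ.ε} x≲ε L.ε-closed))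
      (λ {x} {y} {m} → ≲ᴸ-ultrametric {x} {y} {m})
      (λ {x} {y} → ≲ᴸ-conj {x} {y})
      (λ _ → em)

    -- Minimality of `L`.

    module _ {H : Pred Gᵍ.Carrier a} (H-good : IsNormalConvexWithValuationalQuotient Gᵍ H) where

      open IsNormalConvexWithValuationalQuotient H-good
      private module H = IsNormalSubgroup isNormalSubgroup

      -- In the quotient, inverting `x ⁻¹` cannot raise it, and off `H` the induced inequality is
      -- the original one, so `x ≲ x ⁻¹`.
      ∉H⇒¬O⁺Type : ∀ {x} → x ∉ H → ¬ O⁺Type G (proj₁ x)
      ∉H⇒¬O⁺Type {x} x∉H x⁻¹≺x
        with valuational⇒⁻¹-mono (quotient Gᵍ.group isNormalSubgroup) (Induced Gᵍ H)
               quotientValuational (x Gᵍ.⁻¹)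
      ... | inj₁ x⁻¹⁻¹∈H = x∉H (H.resp (⁻¹-involutive _) x⁻¹⁻¹∈H)
      ... | inj₂ (_ , x⁻¹⁻¹≲x⁻¹) =
        ≺⇒⋧ x⁻¹≺x (≲.trans (≲.reflexive (sym (⁻¹-involutive _))) x⁻¹⁻¹≲x⁻¹)

      ∉H⇒VType : ∀ {x} → x ∉ H → VType G (proj₁ x)
      ∉H⇒VType {x} x∉H = ⊀⇒≳ (∉H⇒¬O⁺Type x∉H) , ⊀⇒≳ (λ x≺x⁻¹ →
        ∉H⇒¬O⁺Type {x Gᵍ.⁻¹} (λ x⁻¹∈H → x∉H (H.resp (⁻¹-involutive _) (H.⁻¹-closed x⁻¹∈H)))
          (≺-resp (sym (⁻¹-involutive _)) refl x≺x⁻¹))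

      -- An element of L outside H would be v-type, hence separated from g by an o⁺-type
      -- element c; but c ≲ g puts c in the group, and convexity puts it outside H.
      L⊆H : ∀ {x} → x ∈ L⟨Gᵍ⟩ → x ∈ H
      L⊆H {x , x∈U} x∈L = decidable-stable em λ x∉H →
        L⇒∉T x∈L (∉H⇒VType x∉H , x≉ε x∉H , λ where
          (c , o , inj₂ (g≲c , c≲x)) → ≺⇒⋧ (L⇒≺ x∈L g∈T) (≲.trans g≲c c≲x)
          (c , o , inj₁ (x≲c , c≲g)) →
            let c∈U = Bounded⇒U g∈T (c≲g , ≲.trans (proj₁ o) c≲g) in
            ∉H⇒¬O⁺Type {c , c∈U} (λ c∈H → x∉H (convex H.ε-closed c∈H (ε≲ x) x≲c)) o)
        where
        x≉ε : (x , x∈U) ∉ H → ¬ (x ≈ ε)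
        x≉ε x∉H x≈ε = x∉H (H.resp (sym x≈ε) H.ε-closed)

proposition3p30 : {a : Level} → ExcludedMiddle a →
    (G : CQuasiOrderedGroup a) → let open CQuasiOrderedGroup G in
    (g : Carrier) → ¬ (g ≈ ε) → VType G g →
    Σ[ isSub ∈ IsSubgroup group (Upper[_] G g) ]
    IsSmallest (IsNormalConvexWithValuationalQuotient (restrict G isSub))
    (λ h → Lower[_] G g (proj₁ h))
proposition3p30 em G g g≉ε vg = U-isSubgroup em G g g≉ε vg
  , record
    { isNormalSubgroup    = L-isNormal em G g g≉ε vg
    -- The lower group is closed downwards under `_≲_`, hence convex.
    ; convex              = λ _ t∈L _ x≲t u u∈T → ≲-≺-trans em G x≲t (t∈L u u∈T)
    ; quotientValuational = Gᵍ/L-valuational em G g g≉ε vg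
    }
  , λ H H-good → L⊆H em G g g≉ε vg H-good
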